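{- The derivation of the extended tableau is valid; that is: if $\mathbf{T}=(G,\mathcal{G},\mathcal{M},\mathcal{X},\simeq)$ is a valid matroid tableau, then its extended tableau $[\mathbf{T}]_\equiv$ is a valid matroid tableau.
   Context: Matroids have finite ground sets; $M^\ast$ denotes the dual matroid of $M$. A digraph is a pair $D=(V,A)$ with $V$ finite and $A\subseteq V\times V$. A path in $D$ is a non-empty, non-repeating sequence of vertices $p_1p_2\ldots p_n$ with $(p_i,p_{i+1})\in A$ for $1\le i<n$. A routing from $X$ to $Y$ in $D$ is a family $R$ of paths in $D$ such that every $x\in X$ is the first vertex of some $p\in R$, every $p\in R$ ends in a vertex of $Y$, and any two distinct paths of $R$ are vertex-disjoint. For $E,T\subseteq V$, $\Gamma(D,T,E)$ is the matroid on $E$ whose independent sets are those $X\subseteq E$ for which there is a routing from $X$ to $T$ in $D$. A matroid $(E,\mathcal{I})$ is a gammoid if it equals $\Gamma(D,T,E)$ for some digraph $D=(V,A)$ with $E\subseteq V$ and some $T\subseteq V$; it is a strict gammoid if such a representation exists with $V=E$. A matroid tableau is a tuple $\mathbf{T}=(G,\mathcal{G},\mathcal{M},\mathcal{X},\simeq)$ where $G$ is a matroid (the goal), $\mathcal{G},\mathcal{M},\mathcal{X}$ are families of matroids, and $\simeq$ is an equivalence relation on $\{G'\mid G'\text{ is a minor of }G\}\cup\mathcal{G}\cup\mathcal{M}\cup\mathcal{X}$. $\mathbf{T}$ is valid if (i) all matroids in $\mathcal{G}$ are gammoids, (ii) no matroid in $\mathcal{M}$ is a strict gammoid, (iii) no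 matroid in $\mathcal{X}$ is a gammoid, and (iv) every equivalence class of $\simeq$ either consists only of gammoids or contains no gammoid. The extended tableau of $\mathbf{T}$ is $[\mathbf{T}]_\equiv=(G,\mathcal{G}',\mathcal{M}',\mathcal{X}',\simeq')$ with $\mathcal{G}'=\mathcal{G}\cup\{M^\ast\mid M\in\mathcal{G}\}$, $\mathcal{X}'=\mathcal{X}\cup\{M^\ast\mid M\in\mathcal{X}\}$, $\mathcal{M}'=\mathcal{M}\cup\mathcal{X}'$, and $\simeq'$ the smallest equivalence relation on $\{G'\mid G'\text{ is a minor of }G\}\cup\mathcal{G}'\cup\mathcal{M}'\cup\mathcal{X}'$ that contains $\simeq$ and $\sim$, where for matroids $M,N$ of this family $M\sim N$ if and only if $N$ is isomorphic to $M$ or to $M^\ast$. -}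

module Defs where

open import Level using (0ℓ) renaming (suc to lsuc)
open import Data.Nat.Base using (ℕ; zero; suc; _+_; _∸_; _≤_; _<_; s≤s)
import Data.Nat.Properties as ℕ
open import Data.Bool.Base using (true; false)
open import Data.Fin.Base using (Fin)
import Data.Fin.Properties as Fin
open import Data.Fin.Subset
open import Data.Fin.Subset.Properties
open import Data.Vec.Base using (tabulate; []; _∷_)
open import Data.Vec.Properties using (lookup∘tabulate; lookup⇒[]=; []=⇒lookup)
open import Data.List.Base using (List)
open import Data.List.NonEmpty.Base using (List⁺; head; last; toList)
open import Data.List.Membership.Propositional using () renaming (_∈_ to _∈ˡ_)
open import Data.List.Relation.Unary.Linked using (Linked)
open import Data.List.Relation.Unary.Unique.Propositional using (Unique)
open import Data.List.Relation.Binary.Disjoint.Propositional using (Disjoint)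
open import Data.Product.Base using (∃; ∃-syntax; Σ-syntax; _×_; _,_; proj₁; proj₂)
open import Data.Sum.Base using (_⊎_; inj₁; inj₂; [_,_])
open import Function.Base using (_∘_)
open import Function.Bundles using (_⇔_; mk⇔; Equivalence; _↔_; Inverse)
open import Function.Construct.Identity using (↔-id)
open import Function.Construct.Symmetry using (↔-sym)
open import Function.Construct.Composition using (_↔-∘_)
open import Function.Definitions using (Injective; Surjective)
open import Relation.Binary.Core using (Rel)
open import Relation.Binary.Structures using (IsEquivalence)
import Relation.Binary.Definitions as B
open import Relation.Binary.Construct.Closure.Equivalence as EqC using (EqClosure)
open import Relation.Binary.Construct.Closure.Symmetric using (fwd; bwd)
open import Relation.Binary.Construct.Closure.ReflexiveTransitive using (ε; _◅_)
open import Relation.Binary.PropositionalEquality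
  using (_≡_; _≢_; refl; sym; trans; cong; subst; module ≡-Reasoning)
open import Relation.Nullary.Decidable.Core using (Dec; yes; no; does; _×-dec_; ¬?; decidable-stable)
open import Relation.Nullary.Decidable using (dec-true; map′)
open import Relation.Nullary.Negation.Core using (¬_; contradiction)
open import Relation.Unary using (Pred; Decidable; _≐_) renaming (_∪_ to _∪ᵖ_)

private
  variable
    m n k : ℕ

image : (Fin m → Fin n) → Subset m → Subset n
image f X = tabulate λ j → does (Fin.any? λ i → (i ∈? X) ×-dec (f i Fin.≟ j))

-- A matroid whose ground set is a finite set of labels from U.  The ground set
-- is enumerated by an injective map, and its subsets are written as subsets of
-- the index set; decidability of independence is automatic classically.
record Matroid (U : Set) : Set₁ where
  field
    size            : ℕ
    label           : Fin size → U
    label-injective : Injective _≡_ _≡_ label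
    Indep           : Pred (Subset size) 0ℓ
    indep?          : Decidable Indep
    indep-⊥         : Indep ⊥
    indep-⊆         : ∀ {X Y} → X ⊆ Y → Indep Y → Indep X
    augment         : ∀ {X Y} → Indep X → Indep Y → ∣ X ∣ < ∣ Y ∣ →
                      ∃[ y ] y ∈ Y × y ∉ X × Indep (X ∪ ⁅ y ⁆)

  Base : Pred (Subset size) 0ℓ
  Base B = Indep B × (∀ {X} → Indep X → B ⊆ X → X ⊆ B)

  -- The complements of the bases are the bases of the dual matroid.
  DualIndep : Pred (Subset size) 0ℓ
  DualIndep X = ∃[ B ] Base B × X ⊆ ∁ B

open Matroid

∣∪∣+∣∩∣ : (p q : Subset n) → ∣ p ∪ q ∣ + ∣ p ∩ q ∣ ≡ ∣ p ∣ + ∣ q ∣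
∣∪∣+∣∩∣ []          []          = refl
∣∪∣+∣∩∣ (true ∷ p)  (true ∷ q)  = cong suc (trans (ℕ.+-suc _ _)
  (trans (cong suc (∣∪∣+∣∩∣ p q)) (sym (ℕ.+-suc _ _))))
∣∪∣+∣∩∣ (true ∷ p)  (false ∷ q) = cong suc (∣∪∣+∣∩∣ p q)
∣∪∣+∣∩∣ (false ∷ p) (true ∷ q)  = trans (cong suc (∣∪∣+∣∩∣ p q)) (sym (ℕ.+-suc _ _))
∣∪∣+∣∩∣ (false ∷ p) (false ∷ q) = ∣∪∣+∣∩∣ p q

∣∩∣+∣─∣ : (p q : Subset n) → ∣ p ∩ q ∣ + ∣ p ─ q ∣ ≡ ∣ p ∣
∣∩∣+∣─∣ []          []          = refl
∣∩∣+∣─∣ (true ∷ p)  (true ∷ q)  = cong suc (∣∩∣+∣─∣ p q)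
∣∩∣+∣─∣ (true ∷ p)  (false ∷ q) = trans (ℕ.+-suc _ _) (cong suc (∣∩∣+∣─∣ p q))
∣∩∣+∣─∣ (false ∷ p) (true ∷ q)  = ∣∩∣+∣─∣ p q
∣∩∣+∣─∣ (false ∷ p) (false ∷ q) = ∣∩∣+∣─∣ p q

x∈p─q⇒x∉q : ∀ {x} (p q : Subset n) → x ∈ p ─ q → x ∉ q
x∈p─q⇒x∉q p q x∈p─q x∈q = ∉⊥
  (subst (_ ∈_) (∩-─ p q) (x∈p∩q⁺ (x∈p─q , x∈q)))
  where
  ∩-─ : ∀ {n} (p q : Subset n) → (p ─ q) ∩ q ≡ ⊥
  ∩-─ []          []          = refl
  ∩-─ (_ ∷ p)     (true ∷ q)  = cong (false ∷_) (∩-─ p q)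
  ∩-─ (true ∷ p)  (false ∷ q) = cong (false ∷_) (∩-─ p q)
  ∩-─ (false ∷ p) (false ∷ q) = cong (false ∷_) (∩-─ p q)

disjoint-∣∪∣ : (p q : Subset n) → (∀ {x} → x ∈ p → x ∉ q) → ∣ p ∪ q ∣ ≡ ∣ p ∣ + ∣ q ∣
disjoint-∣∪∣ {n} p q dis = begin
  ∣ p ∪ q ∣               ≡⟨ ℕ.+-identityʳ _ ⟨
  ∣ p ∪ q ∣ + 0           ≡⟨ cong (∣ p ∪ q ∣ +_) (∣⊥∣≡0 n) ⟨
  ∣ p ∪ q ∣ + ∣ ⊥ {n} ∣   ≡⟨ cong (λ r → ∣ p ∪ q ∣ + ∣ r ∣) p∩q≡⊥ ⟨
  ∣ p ∪ q ∣ + ∣ p ∩ q ∣   ≡⟨ ∣∪∣+∣∩∣ p q ⟩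
  ∣ p ∣ + ∣ q ∣            ∎
  where
  open ≡-Reasoning
  p∩q≡⊥ : p ∩ q ≡ ⊥
  p∩q≡⊥ = ⊆-antisym
    (λ x∈ → let x∈p , x∈q = x∈p∩q⁻ p q x∈ in contradiction x∈q (dis x∈p))
    ⊥⊆

∪-⊆ : {p q r : Subset n} → p ⊆ r → q ⊆ r → p ∪ q ⊆ r
∪-⊆ {p = p} {q} p⊆r q⊆r x∈ = [ p⊆r , q⊆r ] (x∈p∪q⁻ p q x∈)

⁅⁆-⊆ : ∀ {x} {p : Subset n} → x ∈ p → ⁅ x ⁆ ⊆ p
⁅⁆-⊆ x∈p y∈ with refl ← x∈⁅y⁆⇒x≡y _ y∈ = x∈p

∣∪⁅⁆∣ : ∀ {x} (p : Subset n) → x ∉ p → ∣ p ∪ ⁅ x ⁆ ∣ ≡ suc ∣ p ∣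
∣∪⁅⁆∣ {x = x} p x∉p = trans
  (disjoint-∣∪∣ p ⁅ x ⁆ λ y∈p y∈x → x∉p (subst (_∈ p) (x∈⁅y⁆⇒x≡y _ y∈x) y∈p))
  (trans (cong (∣ p ∣ +_) (∣⁅x⁆∣≡1 x)) (ℕ.+-comm ∣ p ∣ 1))

⊆∧∣≥∣⇒⊇ : {p q : Subset n} → p ⊆ q → ∣ q ∣ ≤ ∣ p ∣ → q ⊆ p
⊆∧∣≥∣⇒⊇ {p = p} p⊆q q≤p {x} x∈q with x ∈? p
... | yes x∈p = x∈p
... | no  x∉p = contradiction q≤p
  (ℕ.<⇒≱ (p⊂q⇒∣p∣<∣q∣ (p⊆q , x , x∈q , x∉p)))

allSubset? : {P : Pred (Subset n) 0ℓ} → Decidable P → Dec (∀ X → P X)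
allSubset? P? with anySubset? (¬? ∘ P?)
... | yes (X , ¬PX) = no λ all → ¬PX (all X)
... | no  ¬∃        = yes λ X → decidable-stable (P? X) λ ¬PX → ¬∃ (X , ¬PX)

⇒-dec : {A B : Set} → Dec A → Dec B → Dec (A → B)
⇒-dec (no ¬a) _       = yes λ a → contradiction a ¬a
⇒-dec (yes a) (yes b) = yes λ _ → b
⇒-dec (yes a) (no ¬b) = no λ f → ¬b (f a)

module _ {U : Set} (M : Matroid U) where

  base? : Decidable (Base M)
  base? B = indep? M B ×-dec map′ (λ f {X} → f X) (λ f X → f {X})
    (allSubset? λ X → ⇒-dec (indep? M X) (⇒-dec (B ⊆? X) (X ⊆? B)))

  dualIndep? : Decidable (DualIndep M)
  dualIndep? X = anySubset? λ B → base? B ×-dec (X ⊆? ∁ B)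

  base-maximum : ∀ {B X} → Base M B → Indep M X → ∣ X ∣ ≤ ∣ B ∣
  base-maximum {B} {X} (iB , max) iX with ℕ.≤-<-connex ∣ X ∣ ∣ B ∣
  ... | inj₁ X≤B = X≤B
  ... | inj₂ B<X with y , _ , y∉B , iBy ← augment M iB iX B<X =
    contradiction (max iBy (p⊆p∪q ⁅ y ⁆) (q⊆p∪q B ⁅ y ⁆ (x∈⁅x⁆ y))) y∉B

  maximum-base : ∀ {B K} → Base M B → Indep M K → ∣ K ∣ ≡ ∣ B ∣ → Base M K
  maximum-base bB iK eq = iK , λ iX K⊆X →
    ⊆∧∣≥∣⇒⊇ K⊆X (subst (_ ≤_) (sym eq) (base-maximum bB iX))

  extend : ∀ d {I J} → Indep M I → Indep M J → d + ∣ I ∣ ≡ ∣ J ∣ →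
           ∃[ K ] Indep M K × I ⊆ K × K ⊆ I ∪ J × ∣ K ∣ ≡ ∣ J ∣
  extend zero    {I} {J} iI iJ eq = I , iI , (λ x → x) , p⊆p∪q J , eq
  extend (suc d) {I} {J} iI iJ eq
    with y , y∈J , y∉I , iIy ← augment M iI iJ (subst (suc ∣ I ∣ ≤_) eq (s≤s (ℕ.m≤n+m _ d)))
    with K , iK , Iy⊆K , K⊆ , eqK ← extend d iIy iJ
           (trans (cong (d +_) (∣∪⁅⁆∣ I y∉I)) (trans (ℕ.+-suc d _) eq))
    = K , iK , Iy⊆K ∘ p⊆p∪q ⁅ y ⁆
    , ∪-⊆ (∪-⊆ (p⊆p∪q J) (q⊆p∪q I J ∘ ⁅⁆-⊆ y∈J)) (q⊆p∪q I J) ∘ K⊆ , eqK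

  ∃-base : ∃ (Base M)
  ∃-base = go (size M) (indep-⊥ M) (ℕ.m≤m+n _ _)
    where
    go : ∀ d {X} → Indep M X → size M ≤ d + ∣ X ∣ → ∃ (Base M)
    go zero    {X} iX n≤ = X , iX , λ {Y} iY X⊆Y → ⊆∧∣≥∣⇒⊇ X⊆Y (ℕ.≤-trans (∣p∣≤n Y) n≤)
    go (suc d) {X} iX n≤ with anySubset? (λ Y → indep? M Y ×-dec (∣ X ∣ ℕ.<? ∣ Y ∣))
    ... | yes (Y , iY , X<Y) = go d iY
      (ℕ.≤-trans n≤ (ℕ.≤-trans (ℕ.≤-reflexive (sym (ℕ.+-suc d _))) (ℕ.+-monoʳ-≤ d X<Y)))
    ... | no  none = X , iX , λ iY X⊆Y → ⊆∧∣≥∣⇒⊇ X⊆Y (ℕ.≮⇒≥ λ X<Y → none (_ , iY , X<Y))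

  dual-augment : ∀ {X Y} → DualIndep M X → DualIndep M Y → ∣ X ∣ < ∣ Y ∣ →
                 ∃[ y ] y ∈ Y × y ∉ X × DualIndep M (X ∪ ⁅ y ⁆)
  dual-augment {X} {Y} (B , bB , X⊆∁B) (B′ , bB′ , Y⊆∁B′) X<Y = find
    where
    iI : Indep M (B′ ─ X)
    iI = indep-⊆ M (p─q⊆p B′ X) (proj₁ bB′)

    extended : ∃[ K ] Indep M K × B′ ─ X ⊆ K × K ⊆ (B′ ─ X) ∪ B × ∣ K ∣ ≡ ∣ B ∣
    extended = extend (∣ B ∣ ∸ ∣ B′ ─ X ∣) iI (proj₁ bB) (ℕ.m∸n+n≡m (base-maximum bB iI))

    K : Subset (size M)
    K = proj₁ extended

    iK : Indep M K
    iK = proj₁ (proj₂ extended)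

    I⊆K : B′ ─ X ⊆ K
    I⊆K = proj₁ (proj₂ (proj₂ extended))

    bK : Base M K
    bK = maximum-base bB iK (proj₂ (proj₂ (proj₂ (proj₂ extended))))

    X⊆∁K : X ⊆ ∁ K
    X⊆∁K x∈X = x∉p⇒x∈∁p λ x∈K →
      [ (λ x∈I → x∈p─q⇒x∉q B′ X x∈I x∈X) , x∈∁p⇒x∉p (X⊆∁B x∈X) ]
      (x∈p∪q⁻ (B′ ─ X) B (proj₁ (proj₂ (proj₂ (proj₂ extended))) x∈K))

    X─Y<Y─X : ∣ X ─ Y ∣ < ∣ Y ─ X ∣
    X─Y<Y─X = ℕ.+-cancelˡ-< ∣ X ∩ Y ∣ _ _ (begin-strict
      ∣ X ∩ Y ∣ + ∣ X ─ Y ∣ ≡⟨ ∣∩∣+∣─∣ X Y ⟩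
      ∣ X ∣                 <⟨ X<Y ⟩
      ∣ Y ∣                 ≡⟨ ∣∩∣+∣─∣ Y X ⟨
      ∣ Y ∩ X ∣ + ∣ Y ─ X ∣ ≡⟨ cong (λ Z → ∣ Z ∣ + ∣ Y ─ X ∣) (∩-comm Y X) ⟩
      ∣ X ∩ Y ∣ + ∣ Y ─ X ∣ ∎)
      where open ℕ.≤-Reasoning

    Y─X⊈K : ¬ (Y ─ X ⊆ K)
    Y─X⊈K Y─X⊆K = ℕ.<⇒≱ B′<K (base-maximum bB′ iK)
      where
      open ℕ.≤-Reasoning
      B′<K : ∣ B′ ∣ < ∣ K ∣
      B′<K = begin-strict
        ∣ B′ ∣                     ≡⟨ ∣∩∣+∣─∣ B′ X ⟨
        ∣ B′ ∩ X ∣ + ∣ B′ ─ X ∣    ≤⟨ ℕ.+-monoˡ-≤ _ (p⊆q⇒∣p∣≤∣q∣ λ x∈ →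
                                        let x∈B′ , x∈X = x∈p∩q⁻ B′ X x∈ in
                                        x∈p∧x∉q⇒x∈p─q x∈X λ x∈Y → x∈∁p⇒x∉p (Y⊆∁B′ x∈Y) x∈B′) ⟩
        ∣ X ─ Y ∣ + ∣ B′ ─ X ∣     <⟨ ℕ.+-monoˡ-< _ X─Y<Y─X ⟩
        ∣ Y ─ X ∣ + ∣ B′ ─ X ∣     ≡⟨ disjoint-∣∪∣ (Y ─ X) (B′ ─ X) (λ x∈ x∈′ →
                                        x∈∁p⇒x∉p (Y⊆∁B′ (p─q⊆p Y X x∈)) (p─q⊆p B′ X x∈′)) ⟨
        ∣ (Y ─ X) ∪ (B′ ─ X) ∣    ≤⟨ p⊆q⇒∣p∣≤∣q∣ (∪-⊆ Y─X⊆K I⊆K) ⟩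
        ∣ K ∣                      ∎

    find : ∃[ y ] y ∈ Y × y ∉ X × DualIndep M (X ∪ ⁅ y ⁆)
    find with Fin.any? (λ y → (y ∈? (Y ─ X)) ×-dec ¬? (y ∈? K))
    ... | yes (y , y∈Y─X , y∉K) = y , p─q⊆p Y X y∈Y─X , x∈p─q⇒x∉q Y X y∈Y─X
                                , K , bK , ∪-⊆ X⊆∁K (⁅⁆-⊆ (x∉p⇒x∈∁p y∉K))
    ... | no  none = contradiction
      (λ {y} y∈ → decidable-stable (y ∈? K) λ y∉K → none (y , y∈ , y∉K)) Y─X⊈K

infix 10 _*

_* : {U : Set} → Matroid U → Matroid U
M * = record
  { size            = size M
  ; label           = label M
  ; label-injective = label-injective M
  ; Indep           = DualIndep M
  ; indep?          = dualIndep? M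
  ; indep-⊥         = let B , bB = ∃-base M in B , bB , ⊥⊆
  ; indep-⊆         = λ X⊆Y (B , bB , Y⊆∁B) → B , bB , Y⊆∁B ∘ X⊆Y
  ; augment         = dual-augment M
  }

infix 4 _≅_ _≈_ _∼_

record _≅_ {U : Set} (M N : Matroid U) : Set where
  field
    bijection : Fin (size M) ↔ Fin (size N)
    indep⇔    : ∀ X → Indep M X ⇔ Indep N (image (Inverse.to bijection) X)

-- Equality of matroids: the same ground set and the same independent sets,
-- irrespective of the chosen enumerations of the ground set.
record _≈_ {U : Set} (M N : Matroid U) : Set where
  field
    iso       : M ≅ N
    label-iso : ∀ i → label N (Inverse.to (_≅_.bijection iso) i) ≡ label M i

-- K is the restriction of M to the ground set of K.
record IsRestriction {U : Set} (K M : Matroid U) : Set where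
  field
    inclusion   : Fin (size K) → Fin (size M)
    label-incl  : ∀ i → label M (inclusion i) ≡ label K i
    indep⇔      : ∀ X → Indep K X ⇔ Indep M (image inclusion X)

-- Contraction is restriction in the dual: N = (K* | E(N))*.
IsContraction : {U : Set} → Matroid U → Matroid U → Set
IsContraction N K = IsRestriction (N *) (K *)

Minor : {U : Set} → Matroid U → Matroid U → Set₁
Minor N M = ∃[ K ] IsRestriction K M × IsContraction N K

record Digraph : Set₁ where
  field
    order : ℕ
    Arc   : Rel (Fin order) 0ℓ
    arc?  : B.Decidable Arc

module _ (D : Digraph) where
  open Digraph D

  IsPath : Pred (List⁺ (Fin order)) 0ℓ
  IsPath p = Linked Arc (toList p) × Unique (toList p)

  -- The list R stands for the set of its members.
  record IsRouting (X Y : Subset order) (R : List (List⁺ (Fin order))) : Set where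
    field
      paths    : ∀ {p} → p ∈ˡ R → IsPath p
      starts   : ∀ {x} → x ∈ X → ∃[ p ] p ∈ˡ R × head p ≡ x
      ends     : ∀ {p} → p ∈ˡ R → last p ∈ Y
      disjoint : ∀ {p q} → p ∈ˡ R → q ∈ˡ R → p ≢ q → Disjoint (toList p) (toList q)

  -- The independent sets of Γ(D,T,E), where E is the set of vertices
  -- enumerated by e.
  Γ : Subset order → (e : Fin n → Fin order) → Pred (Subset n) 0ℓ
  Γ T e X = ∃ (IsRouting (image e X) T)

-- Vertices are only named by Fin order, so the inclusion E ⊆ V is
-- an injection of the index set of E.
record Representation {U : Set} (M : Matroid U) : Set₁ where
  field
    D           : Digraph
    T           : Subset (Digraph.order D)
    e           : Fin (size M) → Fin (Digraph.order D)
    e-injective : Injective _≡_ _≡_ e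
    represents  : Indep M ≐ Γ D T e

Gammoid : {U : Set} → Pred (Matroid U) (lsuc 0ℓ)
Gammoid M = Representation M

StrictGammoid : {U : Set} → Pred (Matroid U) (lsuc 0ℓ)
StrictGammoid M = Σ[ R ∈ Representation M ] Surjective _≡_ _≡_ (Representation.e R)

∈-image⁺ : (f : Fin m → Fin n) (X : Subset m) → ∀ {i} → i ∈ X → f i ∈ image f X
∈-image⁺ f X {i} i∈X = lookup⇒[]= (f i) _ (trans (lookup∘tabulate _ (f i))
  (dec-true (Fin.any? λ i′ → (i′ ∈? X) ×-dec (f i′ Fin.≟ f i)) (i , i∈X , refl)))

∈-image⁻ : (f : Fin m → Fin n) (X : Subset m) → ∀ {j} → j ∈ image f X → ∃[ i ] i ∈ X × f i ≡ j
∈-image⁻ f X {j} j∈ with trans (sym (lookup∘tabulate _ j)) ([]=⇒lookup j∈)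
... | eq with Fin.any? (λ i → (i ∈? X) ×-dec (f i Fin.≟ j))
...   | yes found = found

image-∘ : (g : Fin n → Fin k) (f : Fin m → Fin n) (X : Subset m) →
          image g (image f X) ≡ image (g ∘ f) X
image-∘ g f X = ⊆-antisym to from
  where
  to : image g (image f X) ⊆ image (g ∘ f) X
  to x∈ with j , j∈ , refl ← ∈-image⁻ g _ x∈
        with i , i∈ , refl ← ∈-image⁻ f X j∈ = ∈-image⁺ (g ∘ f) X i∈
  from : image (g ∘ f) X ⊆ image g (image f X)
  from x∈ with i , i∈ , refl ← ∈-image⁻ (g ∘ f) X x∈ = ∈-image⁺ g _ (∈-image⁺ f X i∈)

image-id : (f : Fin m → Fin m) → (∀ i → f i ≡ i) → (X : Subset m) → image f X ≡ X
image-id f f≗id X = ⊆-antisym to from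
  where
  to : image f X ⊆ X
  to x∈ with i , i∈ , refl ← ∈-image⁻ f X x∈ = subst (_∈ X) (sym (f≗id i)) i∈
  from : X ⊆ image f X
  from {i} i∈ = subst (_∈ image f X) (f≗id i) (∈-image⁺ f X i∈)

module _ {U : Set} where

  ≅-refl : {M : Matroid U} → M ≅ M
  ≅-refl {M} = record
    { bijection = ↔-id _
    ; indep⇔    = λ X → let eq = image-id (λ i → i) (λ _ → refl) X in
                  mk⇔ (subst (Indep M) (sym eq)) (subst (Indep M) eq)
    }

  ≅-sym : {M N : Matroid U} → M ≅ N → N ≅ M
  ≅-sym {M} {N} φ = record
    { bijection = ↔-sym bijection
    ; indep⇔    = λ Y →
        let eq = trans (image-∘ to from Y) (image-id (to ∘ from) strictlyInverseˡ Y)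
            module E = Equivalence (indep⇔ (image from Y))
        in mk⇔ (E.from ∘ subst (Indep N) (sym eq)) (subst (Indep N) eq ∘ E.to)
    }
    where
    open _≅_ φ
    open Inverse bijection

  ≅-trans : {L M N : Matroid U} → L ≅ M → M ≅ N → L ≅ N
  ≅-trans {N = N} φ ψ = record
    { bijection = ψ.bijection ↔-∘ φ.bijection
    ; indep⇔    = λ X →
        let eq = image-∘ (Inverse.to ψ.bijection) (Inverse.to φ.bijection) X
            module E = Equivalence (φ.indep⇔ X)
            module F = Equivalence (ψ.indep⇔ (image (Inverse.to φ.bijection) X))
        in mk⇔ (subst (Indep N) eq ∘ F.to ∘ E.to) (E.from ∘ F.from ∘ subst (Indep N) (sym eq))
    }
    where
    module φ = _≅_ φ
    module ψ = _≅_ ψ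

  ≈-refl : {M : Matroid U} → M ≈ M
  ≈-refl = record { iso = ≅-refl ; label-iso = λ _ → refl }

  ≈-sym : {M N : Matroid U} → M ≈ N → N ≈ M
  ≈-sym {M} {N} φ = record
    { iso       = ≅-sym iso
    ; label-iso = λ j → trans (sym (label-iso (from j))) (cong (label N) (strictlyInverseˡ j))
    }
    where
    open _≈_ φ
    open Inverse (_≅_.bijection iso)

  ≈-trans : {L M N : Matroid U} → L ≈ M → M ≈ N → L ≈ N
  ≈-trans φ ψ = record
    { iso       = ≅-trans (_≈_.iso φ) (_≈_.iso ψ)
    ; label-iso = λ i → trans (_≈_.label-iso ψ _) (_≈_.label-iso φ i)
    }

  -- A set of matroids, as a predicate compatible with equality of matroids.
  record Family : Set₂ where
    field
      Member   : Pred (Matroid U) (lsuc 0ℓ)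
      respects : Member B.Respects _≈_

open Family public

infixr 6 _∪ᶠ_

_∪ᶠ_ : {U : Set} → Family {U} → Family {U} → Family {U}
𝒜 ∪ᶠ ℬ = record
  { Member   = Member 𝒜 ∪ᵖ Member ℬ
  ; respects = λ M≈N → [ inj₁ ∘ respects 𝒜 M≈N , inj₂ ∘ respects ℬ M≈N ]
  }

duals : {U : Set} → Family {U} → Family {U}
duals 𝒜 = record
  { Member   = λ N → ∃[ M ] Member 𝒜 M × N ≈ M *
  ; respects = λ N≈N′ (M , M∈𝒜 , N≈M*) → M , M∈𝒜 , ≈-trans (≈-sym N≈N′) N≈M*
  }

module _ {U : Set} (G : Matroid U) (𝒢 ℳ 𝒳 : Family {U}) where

  InDomain : Pred (Matroid U) (lsuc 0ℓ)
  InDomain M = Minor M G ⊎ Member 𝒢 M ⊎ Member ℳ M ⊎ Member 𝒳 M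

  Domain : Set₁
  Domain = ∃ InDomain

record Tableau (U : Set) : Set₂ where
  field
    goal          : Matroid U
    𝒢 ℳ 𝒳         : Family {U}
    _≃_           : Rel (Domain goal 𝒢 ℳ 𝒳) (lsuc 0ℓ)
    isEquivalence : IsEquivalence _≃_
    -- ≃ relates matroids, not their descriptions: equal matroids are equivalent.
    ≃-reflexive   : ∀ {x y} → proj₁ x ≈ proj₁ y → x ≃ y

record Valid {U : Set} (𝐓 : Tableau U) : Set₂ where
  open Tableau 𝐓
  field
    𝒢-gammoids : ∀ {M} → Member 𝒢 M → Gammoid M
    ℳ-nonstrict : ∀ {M} → Member ℳ M → ¬ StrictGammoid M
    𝒳-nongammoids : ∀ {M} → Member 𝒳 M → ¬ Gammoid M
    classes : ∀ x → (∀ y → x ≃ y → Gammoid (proj₁ y)) ⊎ (∀ y → x ≃ y → ¬ Gammoid (proj₁ y))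

_∼_ : {U : Set} → Rel (Matroid U) 0ℓ
M ∼ N = N ≅ M ⊎ N ≅ M *

module _ {U : Set} (𝐓 : Tableau U) where
  open Tableau 𝐓

  𝒢′ 𝒳′ ℳ′ : Family {U}
  𝒢′ = 𝒢 ∪ᶠ duals 𝒢
  𝒳′ = 𝒳 ∪ᶠ duals 𝒳
  ℳ′ = ℳ ∪ᶠ 𝒳′

  data Generator (x y : Domain goal 𝒢′ ℳ′ 𝒳′) : Set₁ where
    from-≃ : ∀ m n → (proj₁ x , m) ≃ (proj₁ y , n) → Generator x y
    from-∼ : proj₁ x ∼ proj₁ y → Generator x y

  extended : Tableau U
  extended = record
    { goal          = goal
    ; 𝒢             = 𝒢′
    ; ℳ             = ℳ′
    ; 𝒳             = 𝒳′
    ; _≃_           = EqClosure Generator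
    ; isEquivalence = EqC.isEquivalence Generator
    ; ≃-reflexive   = λ x≈y → bwd (from-∼ (inj₁ (_≈_.iso x≈y))) ◅ ε
    }

{-# OPTIONS --safe #-}
module Submission where

-- The heart of the matter is that the dual of a gammoid is a gammoid; the classes of
-- the extended tableau are then homogeneous, because every generator preserves being
-- a gammoid in both directions.
--
-- By the linkage lemma, X is routed to T exactly when there is an injection σ from V
-- to V ⊎ {1,…,∣X∣} avoiding X, where σ v is v, a successor of v or, for v ∈ T only, one
-- of the extra values: follow the paths from X, and fix the vertices off them.  By
-- counting, σ misses exactly X.  So a set B of rank-many elements of E is a base of
-- M = Γ(D,T,E) iff such a matching of V with (V ⊎ {1,…,r}) ∖ B exists.
--
-- Fix a base B₀ with matching σ₀.  The dual is represented on V ⊎ E: let ρ be σ₀ on V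
-- and the inclusion on B₀, which is a bijection from V ⊎ B₀ onto V ⊎ {1,…,r}.  There is
-- an arc from a to v ∈ V if ρ a is an admissible value at v, and from a to i ∈ E if
-- ρ a = i; the targets are E ∖ B₀.  If B is a base with matching σ, then (σ ⊎ id_B)⁻¹ ∘ ρ
-- is a matching for the new digraph that avoids E ∖ B.  Conversely, for a matching τ of
-- the new digraph avoiding X, the values missed by ρ ∘ τ⁻¹ on V form a base disjoint
-- from X.

open import Defs

open import Data.Nat.Base using (ℕ; zero; suc; _+_; _∸_; _≤_)
import Data.Nat.Properties as ℕ
open import Data.Bool.Base using (true; false)
import Data.Empty as Empty
open import Data.Fin.Base using (Fin; zero; suc; _↑ˡ_; _↑ʳ_; splitAt; join)
import Data.Fin.Properties as Fin
open import Data.Fin.Subset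
open import Data.Fin.Subset.Properties
open import Data.Vec.Base using ([]; _∷_; here; there; tabulate)
open import Data.Vec.Properties using (lookup∘tabulate; lookup⇒[]=; []=⇒lookup)
open import Data.List.Base using (List; []; _∷_; initLast; _∷ʳ′_; allFin; concatMap; length)
open import Data.List.NonEmpty.Base using (List⁺; _∷_; _∷⁺_; head; last; toList)
open import Data.List.Membership.Propositional using (find; lose)
  renaming (_∈_ to _∈ˡ_; _∉_ to _∉ˡ_)
open import Data.List.Membership.Propositional.Properties
  using (∈-allFin; ∈-concatMap⁺; ∈-concatMap⁻)
import Data.List.Membership.DecPropositional as DecMembership
import Data.List.Properties as List
open import Data.List.Relation.Unary.Any as Any using (here; there)
import Data.List.Relation.Unary.All as All
open import Data.List.Relation.Unary.All.Properties using (¬Any⇒All¬; All¬⇒¬Any)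
open import Data.List.Relation.Unary.AllPairs using ([]; _∷_)
open import Data.List.Relation.Unary.Linked using (Linked; [-]; _∷_)
open import Data.List.Relation.Unary.Unique.Propositional using (Unique)
open import Data.Product.Base using (∃; ∃-syntax; _×_; _,_; proj₁; proj₂)
open import Data.Sum.Base using (_⊎_; inj₁; inj₂; [_,_]; [_,_]′)
open import Data.Sum.Properties using (inj₁-injective; inj₂-injective; ≡-dec)
open import Function.Base using (_∘_; id)
open import Function.Bundles using (mk⇔; Equivalence; Inverse)
open import Function.Construct.Identity using (↔-id)
open import Function.Definitions using (Injective)
open import Level using (0ℓ)
open import Relation.Binary.Core using (Rel)
open import Relation.Binary.Structures using (IsEquivalence)
open import Relation.Binary.Construct.Closure.Equivalence as EqC using (EqClosure)
open import Relation.Binary.PropositionalEquality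
  using (_≡_; _≢_; refl; sym; trans; cong; cong₂; subst; subst₂)
open import Relation.Nullary.Decidable
  using (Dec; yes; no; does; _×-dec_; _⊎-dec_; ¬?; map′; dec-true; decidable-stable)
open import Relation.Nullary.Negation.Core using (¬_; contradiction)
open import Relation.Unary using (Pred; Decidable)

open Matroid

private
  variable
    A : Set
    a c m n r : ℕ

-- Subsets of finite sets and counting.

select : {P : Pred (Fin n) 0ℓ} → Decidable P → Subset n
select P? = tabulate (does ∘ P?)

module _ {P : Pred (Fin n) 0ℓ} (P? : Decidable P) where

  ∈-select⁺ : ∀ {i} → P i → i ∈ select P?
  ∈-select⁺ {i} Pi = lookup⇒[]= i _ (trans (lookup∘tabulate _ i) (dec-true (P? i) Pi))

  ∈-select⁻ : ∀ {i} → i ∈ select P? → P i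
  ∈-select⁻ {i} i∈ with trans (sym (lookup∘tabulate _ i)) ([]=⇒lookup i∈)
  ... | eq with P? i
  ...   | yes Pi = Pi

index : (p : Subset n) {x : Fin n} → x ∈ p → Fin ∣ p ∣
index (true  ∷ p) here       = zero
index (true  ∷ p) (there x∈) = suc (index p x∈)
index (false ∷ p) (there x∈) = index p x∈

index-injective : (p : Subset n) {x y : Fin n} (x∈ : x ∈ p) (y∈ : y ∈ p) →
                  index p x∈ ≡ index p y∈ → x ≡ y
index-injective (true  ∷ p) here       here       _  = refl
index-injective (true  ∷ p) (there x∈) (there y∈) eq =
  cong suc (index-injective p x∈ y∈ (Fin.suc-injective eq))
index-injective (false ∷ p) (there x∈) (there y∈) eq =
  cong suc (index-injective p x∈ y∈ eq)

∣image∣ : (f : Fin m → Fin n) → Injective _≡_ _≡_ f → (X : Subset m) → ∣ image f X ∣ ≡ ∣ X ∣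
∣image∣ {m} {n} f inj [] = trans (cong ∣_∣ (⊆-antisym empty ⊥⊆)) (∣⊥∣≡0 n)
  where
  empty : image f [] ⊆ ⊥
  empty x∈ with () , _ ← ∈-image⁻ f [] x∈
∣image∣ {suc m} {n} f inj (false ∷ X) = trans (cong ∣_∣ (⊆-antisym to from))
  (∣image∣ (f ∘ suc) (Fin.suc-injective ∘ inj) X)
  where
  to : image f (false ∷ X) ⊆ image (f ∘ suc) X
  to x∈ with suc i , there i∈ , refl ← ∈-image⁻ f (false ∷ X) x∈ = ∈-image⁺ (f ∘ suc) X i∈
  from : image (f ∘ suc) X ⊆ image f (false ∷ X)
  from x∈ with i , i∈ , refl ← ∈-image⁻ (f ∘ suc) X x∈ = ∈-image⁺ f (false ∷ X) (there i∈)
∣image∣ {suc m} {n} f inj (true ∷ X) = trans (cong ∣_∣ (⊆-antisym to from)) (trans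
  (∣∪⁅⁆∣ (image (f ∘ suc) X) fresh) (cong suc (∣image∣ (f ∘ suc) (Fin.suc-injective ∘ inj) X)))
  where
  fresh : f zero ∉ image (f ∘ suc) X
  fresh x∈ with i , _ , eq ← ∈-image⁻ (f ∘ suc) X x∈ with () ← inj eq
  to : image f (true ∷ X) ⊆ image (f ∘ suc) X ∪ ⁅ f zero ⁆
  to x∈ with ∈-image⁻ f (true ∷ X) x∈
  ... | zero  , _        , refl = q⊆p∪q (image (f ∘ suc) X) _ (x∈⁅x⁆ (f zero))
  ... | suc i , there i∈ , refl = p⊆p∪q _ (∈-image⁺ (f ∘ suc) X i∈)
  from : image (f ∘ suc) X ∪ ⁅ f zero ⁆ ⊆ image f (true ∷ X)
  from = ∪-⊆ lift (⁅⁆-⊆ (∈-image⁺ f (true ∷ X) here))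
    where
    lift : image (f ∘ suc) X ⊆ image f (true ∷ X)
    lift x∈ with i , i∈ , refl ← ∈-image⁻ (f ∘ suc) X x∈ = ∈-image⁺ f (true ∷ X) (there i∈)

module _ {f : Fin a → Fin c} {g : Fin m → Fin c}
         (f-injective : Injective _≡_ _≡_ f) (g-injective : Injective _≡_ _≡_ g)
         (X : Subset m) where

  -- Pigeonhole: the two images are disjoint and their sizes add up to `c`, so their union is
  -- everything.
  disjoint⇒covering : (∀ i {j} → j ∈ X → f i ≢ g j) → a + ∣ X ∣ ≡ c →
                      ∀ w → (∃[ i ] f i ≡ w) ⊎ (∃[ j ] j ∈ X × g j ≡ w)
  disjoint⇒covering dis eq w =
    [ (λ w∈ → let i , _ , fi≡w = ∈-image⁻ f ⊤ w∈ in inj₁ (i , fi≡w))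
    , (λ w∈ → inj₂ (∈-image⁻ g X w∈))
    ] (x∈p∪q⁻ _ _ (subst (w ∈_) (sym full) ∈⊤))
    where
    dis′ : ∀ {x} → x ∈ image f ⊤ → x ∉ image g X
    dis′ x∈ x∈′ with i , _ , refl ← ∈-image⁻ f ⊤ x∈
                with j , j∈ , gj≡fi ← ∈-image⁻ g X x∈′ = dis i j∈ (sym gj≡fi)
    full : image f ⊤ ∪ image g X ≡ ⊤
    full = ∣p∣≡n⇒p≡⊤ (trans (disjoint-∣∪∣ _ _ dis′) (trans
      (cong₂ _+_ (trans (∣image∣ f f-injective ⊤) (∣⊤∣≡n a)) (∣image∣ g g-injective X)) eq))

  covering⇒≤ : (∀ w → (∃[ i ] f i ≡ w) ⊎ (∃[ j ] j ∈ X × g j ≡ w)) → c ≤ a + ∣ X ∣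
  covering⇒≤ cover = begin
    c                                  ≡⟨ ∣⊤∣≡n c ⟨
    ∣ ⊤ {c} ∣                          ≤⟨ p⊆q⇒∣p∣≤∣q∣ {p = ⊤} (λ {w} _ → full w) ⟩
    ∣ image f ⊤ ∪ image g X ∣          ≤⟨ ℕ.m≤m+n _ _ ⟩
    ∣ image f ⊤ ∪ image g X ∣ + _      ≡⟨ ∣∪∣+∣∩∣ (image f ⊤) (image g X) ⟩
    ∣ image f ⊤ ∣ + ∣ image g X ∣      ≡⟨ cong₂ _+_ (trans (∣image∣ f f-injective ⊤) (∣⊤∣≡n a))
                                                    (∣image∣ g g-injective X) ⟩
    a + ∣ X ∣                          ∎
    where
    open ℕ.≤-Reasoning
    full : ∀ w → w ∈ image f ⊤ ∪ image g X
    full w with cover w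
    ... | inj₁ (i , refl)      = p⊆p∪q _ (∈-image⁺ f ⊤ ∈⊤)
    ... | inj₂ (j , j∈ , refl) = q⊆p∪q _ _ (∈-image⁺ g X j∈)

join-injective : ∀ m {n} {s t : Fin m ⊎ Fin n} → join m n s ≡ join m n t → s ≡ t
join-injective m {n} {s} {t} eq = trans (sym (Fin.splitAt-join m n s))
  (trans (cong (splitAt m) eq) (Fin.splitAt-join m n t))

splitAt-injective : ∀ m {n} {i j : Fin (m + n)} → splitAt m i ≡ splitAt m j → i ≡ j
splitAt-injective m {n} {i} {j} eq = trans (sym (Fin.join-splitAt m n i))
  (trans (cong (join m n) eq) (Fin.join-splitAt m n j))

-- Paths and linkages

data Succ {A : Set} : List A → A → A → Set where
  here  : ∀ {x y xs} → Succ (x ∷ y ∷ xs) x y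
  there : ∀ {x y z xs} → Succ xs y z → Succ (x ∷ xs) y z

Succ⇒∈-tail : ∀ {z xs} {x y : A} → Succ (z ∷ xs) x y → y ∈ˡ xs
Succ⇒∈-tail here              = here refl
Succ⇒∈-tail (there s@here)      = there (Succ⇒∈-tail s)
Succ⇒∈-tail (there s@(there _)) = there (Succ⇒∈-tail s)

Linked-Succ : ∀ {R : Rel A 0ℓ} {xs x y} → Linked R xs → Succ xs x y → R x y
Linked-Succ (Rxy ∷ _) here      = Rxy
Linked-Succ (_ ∷ l)   (there s) = Linked-Succ l s

∉-tail : ∀ {x : A} {xs} → Unique (x ∷ xs) → x ∉ˡ xs
∉-tail (x∉ ∷ _) = All¬⇒¬Any x∉

Succ-injective : ∀ {xs} {x y z : A} → Unique xs → Succ xs x z → Succ xs y z → x ≡ y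
Succ-injective u       here      here      = refl
Succ-injective (_ ∷ u) here      (there t) = contradiction (Succ⇒∈-tail t) (∉-tail u)
Succ-injective (_ ∷ u) (there s) here      = contradiction (Succ⇒∈-tail s) (∉-tail u)
Succ-injective (_ ∷ u) (there s) (there t) = Succ-injective u s t

last-∷⁺ : ∀ (x : A) p → last (x ∷⁺ p) ≡ last p
last-∷⁺ x (y ∷ ys) with initLast ys
... | []       = refl
... | zs ∷ʳ′ z = refl

succ-or-last : ∀ {x : A} p → x ∈ˡ toList p → (∃[ y ] Succ (toList p) x y) ⊎ x ≡ last p
succ-or-last (x ∷ [])     (here refl) = inj₂ refl
succ-or-last (x ∷ y ∷ ys) (here refl) = inj₁ (y , here)
succ-or-last (x ∷ y ∷ ys) (there z∈)  with succ-or-last (y ∷ ys) z∈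
... | inj₁ (w , s) = inj₁ (w , there s)
... | inj₂ eq      = inj₂ (trans eq (sym (last-∷⁺ x (y ∷ ys))))

module _ (D : Digraph) (T : Subset (Digraph.order D)) where
  open Digraph D

  -- A step into Fin r ends a path.
  Admissible : Fin order → Fin order ⊎ Fin r → Set
  Admissible v (inj₁ w) = v ≡ w ⊎ Arc v w
  Admissible v (inj₂ _) = v ∈ T

  admissible? : (v : Fin order) (s : Fin order ⊎ Fin r) → Dec (Admissible v s)
  admissible? v (inj₁ w) = (v Fin.≟ w) ⊎-dec arc? v w
  admissible? v (inj₂ _) = v ∈? T

  -- The parameter `r` is kept apart from `∣ X ∣`: a routing can be read off a linkage for any `r`,
  -- while the counting in `exhausts` requires `∣ X ∣ ≡ r`.
  record Linkage (X : Subset order) (r : ℕ) : Set where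
    field
      step           : Fin order → Fin order ⊎ Fin r
      step-injective : Injective _≡_ _≡_ step
      admissible     : ∀ v → Admissible v (step v)
      avoids         : ∀ {v x} → step v ≡ inj₁ x → x ∉ X

  module _ {X : Subset order} (L : Linkage X r) (∣X∣≡r : ∣ X ∣ ≡ r) where
    open Linkage L

    -- The `order` distinct values of `step` all lie outside `X`; together with the `r` elements of
    -- `X` they account for all `order + r` possible values.
    exhausts : ∀ w → (∀ {x} → w ≡ inj₁ x → x ∉ X) → ∃[ v ] step v ≡ w
    exhausts w w∉X with disjoint⇒covering
      {f = join order r ∘ step} {g = _↑ˡ r} (step-injective ∘ join-injective order {r})
      (Fin.↑ˡ-injective r _ _) X
      (λ v x∈ eq → avoids (join-injective order {r} {step v} {inj₁ _} eq) x∈)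
      (cong (order +_) ∣X∣≡r) (join order r w)
    ... | inj₁ (v , eq)      = v , join-injective order {r} eq
    ... | inj₂ (x , x∈ , eq) = contradiction x∈ (w∉X (sym (join-injective order {r} {inj₁ x} eq)))

  -- From routings to linkages.

  module _ {X : Subset order} (R : List (List⁺ (Fin order))) (routing : IsRouting D X T R) where
    open IsRouting routing
    open DecMembership (Fin._≟_ {order}) using () renaming (_∈?_ to _∈ˡ?_)

    meet⇒≡ : ∀ {p q v} → p ∈ˡ R → q ∈ˡ R → v ∈ˡ toList p → v ∈ˡ toList q → p ≡ q
    meet⇒≡ {p} {q} p∈ q∈ v∈p v∈q = decidable-stable (p ≟⁺ q) λ p≢q → disjoint p∈ q∈ p≢q (v∈p , v∈q)
      where
      _≟⁺_ : (p q : List⁺ (Fin order)) → Dec (p ≡ q)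
      (x ∷ xs) ≟⁺ (y ∷ ys) = map′ (λ { (refl , refl) → refl }) (λ { refl → refl , refl })
        ((x Fin.≟ y) ×-dec List.≡-dec Fin._≟_ xs ys)

    -- Paths of `R` that start outside `X` are ignored, so their vertices stay. The remaining paths
    -- have distinct starts in `X`, so the index of its start can serve as the extra value at which
    -- a path leaves.
    data Step (v : Fin order) : Fin order ⊎ Fin ∣ X ∣ → Set where
      stay  : (∀ {p} → p ∈ˡ R → head p ∈ X → v ∉ˡ toList p) → Step v (inj₁ v)
      move  : ∀ {p w} → p ∈ˡ R → head p ∈ X → Succ (toList p) v w → Step v (inj₁ w)
      leave : ∀ {p} → p ∈ˡ R → (h∈ : head p ∈ X) → v ≡ last p → Step v (inj₂ (index X h∈))

    next : ∀ v → ∃ (Step v)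
    next v with Any.any? (λ p → (head p ∈? X) ×-dec (v ∈ˡ? toList p)) R
    ... | no  none = inj₁ v , stay λ p∈ h∈ v∈ → none (lose p∈ (h∈ , v∈))
    ... | yes any with p , p∈ , h∈ , v∈ ← find any with succ-or-last p v∈
    ...   | inj₁ (w , s) = inj₁ w , move p∈ h∈ s
    ...   | inj₂ eq      = inj₂ _ , leave p∈ h∈ eq

    Succ-target : ∀ {p : List⁺ (Fin order)} {v w} → Succ (toList p) v w → w ∈ˡ toList p
    Succ-target = there ∘ Succ⇒∈-tail

    -- A vertex that stays lies on no followed path, so nothing moves into it. Two moves into one
    -- vertex happen on the same path, which does not repeat vertices. Equal extra values mean equal
    -- starts, hence equal paths and equal ends.
    Step-injective : ∀ {v w s t} → Step v s → Step w t → s ≡ t → v ≡ w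
    Step-injective (stay _)  (stay _)          refl = refl
    Step-injective (stay v∉) (move p∈ h∈ s)    refl = contradiction (Succ-target s) (v∉ p∈ h∈)
    Step-injective (move p∈ h∈ s) (stay v∉)    refl = contradiction (Succ-target s) (v∉ p∈ h∈)
    Step-injective (move p∈ _ s) (move q∈ _ t) refl
      with refl ← meet⇒≡ p∈ q∈ (Succ-target s) (Succ-target t) =
      Succ-injective (proj₂ (paths p∈)) s t
    Step-injective (leave p∈ h∈ refl) (leave q∈ k∈ refl) eq =
      cong last (meet⇒≡ p∈ q∈ (here refl) (here (index-injective X h∈ k∈ (inj₂-injective eq))))

    Step-admissible : ∀ {v s} → Step v s → Admissible v s
    Step-admissible (stay _)          = inj₁ refl
    Step-admissible (move p∈ _ s)     = inj₂ (Linked-Succ (proj₁ (paths p∈)) s)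
    Step-admissible (leave p∈ _ refl) = ends p∈

    -- An element of `X` heads a followed path, so it does not stay; a move into it would make it
    -- occur a second time on that path.
    Step-avoids : ∀ {v x} → Step v (inj₁ x) → x ∉ X
    Step-avoids (stay v∉) x∈X with p , p∈ , refl ← starts x∈X = v∉ p∈ x∈X (here refl)
    Step-avoids (move p∈ _ s) x∈X with q , q∈ , refl ← starts x∈X
      with refl ← meet⇒≡ p∈ q∈ (Succ-target s) (here refl) =
      ∉-tail (proj₂ (paths p∈)) (Succ⇒∈-tail s)

    routing⇒linkage : Linkage X ∣ X ∣
    routing⇒linkage = record
      { step           = proj₁ ∘ next
      ; step-injective = Step-injective (proj₂ (next _)) (proj₂ (next _))
      ; admissible     = Step-admissible ∘ proj₂ ∘ next
      ; avoids         = λ {v} eq → Step-avoids (subst (Step v) eq (proj₂ (next v)))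
      }

  -- From linkages to routings.

  module _ {X : Subset order} (L : Linkage X r) where
    open Linkage L

    -- The orbit of a vertex under `step` up to its exit. As the type is inductive, a run witnesses
    -- that the orbit is finite; existence is shown in `run`.
    data Run : Fin order → List⁺ (Fin order) → Set where
      stop : ∀ {v s} → step v ≡ inj₂ s → Run v (v ∷ [])
      go   : ∀ {v w p} → step v ≡ inj₁ w → Run w p → Run v (v ∷⁺ p)

    Run-deterministic : ∀ {v p q} → Run v p → Run v q → p ≡ q
    Run-deterministic (stop _)  (stop _)  = refl
    Run-deterministic (stop eq) (go eq′ _) with () ← trans (sym eq) eq′
    Run-deterministic (go eq _) (stop eq′) with () ← trans (sym eq) eq′
    Run-deterministic (go eq r₁) (go eq′ r₂) with refl ← trans (sym eq) eq′ =
      cong (_ ∷⁺_) (Run-deterministic r₁ r₂)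

    Run-head : ∀ {v p} → Run v p → head p ≡ v
    Run-head (stop _) = refl
    Run-head (go _ _) = refl

    Run-suffix : ∀ {v p w} → Run v p → w ∈ˡ toList p →
                 ∃[ q ] Run w q × length (toList q) ≤ length (toList p)
    Run-suffix ρ@(stop _)  (here refl) = _ , ρ , ℕ.≤-refl
    Run-suffix ρ@(go _ _)  (here refl) = _ , ρ , ℕ.≤-refl
    Run-suffix (go _ ρ)    (there w∈)  =
      let q , ρ′ , q≤ = Run-suffix ρ w∈ in q , ρ′ , ℕ.m≤n⇒m≤1+n q≤

    -- A repeated vertex would have two runs of different lengths.
    Run-unique : ∀ {v p} → Run v p → Unique (toList p)
    Run-unique (stop _) = All.[] ∷ []
    Run-unique ρ@(go _ ρ′) = ¬Any⇒All¬ _ v∉ ∷ Run-unique ρ′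
      where
      v∉ : _
      v∉ v∈ with q , ρ″ , q≤ ← Run-suffix ρ′ v∈ with refl ← Run-deterministic ρ ρ″ = ℕ.1+n≰n q≤

    Run-linked : ∀ {v p} → Run v p → Linked Arc (toList p)
    Run-linked (stop _) = [-]
    Run-linked {v} ρ@(go {w = w} {p = p} eq ρ′) with refl ← Run-head ρ′
      with subst (Admissible v) eq (admissible v)
    -- A fixed vertex would occur twice in its own run, so every move along a run uses an arc.
    ... | inj₁ refl = contradiction (here refl) (∉-tail (Run-unique ρ))
    ... | inj₂ arc  = arc ∷ Run-linked ρ′

    Run-last : ∀ {v p} → Run v p → last p ∈ T
    Run-last {v} (stop eq) = subst (Admissible v) eq (admissible v)
    Run-last (go {v} {p = p} _ ρ) = subst (_∈ T) (sym (last-∷⁺ v p)) (Run-last ρ)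

    Run-predecessor : ∀ {v p w} → Run v p → w ∈ˡ toList p →
                      w ≡ v ⊎ ∃[ u ] u ∈ˡ toList p × step u ≡ inj₁ w
    Run-predecessor (stop _) (here refl) = inj₁ refl
    Run-predecessor (go _ _) (here refl) = inj₁ refl
    Run-predecessor (go {v} eq ρ) (there w∈) with Run-predecessor ρ w∈
    ... | inj₁ refl           = inj₂ (v , here refl , eq)
    ... | inj₂ (u , u∈ , eq′) = inj₂ (u , there u∈ , eq′)

    -- Go back along `p` from the common vertex. Injectivity of `step` forces the predecessors on
    -- `q` to be the same ones, and the walk cannot stop early at `y`, since nothing steps into `X`.
    Run-meet : ∀ {x y p q v} → y ∈ X → Run x p → Run y q →
               v ∈ˡ toList p → v ∈ˡ toList q → x ∈ˡ toList q ⊎ y ∈ˡ toList p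
    Run-meet y∈ (stop _) _ (here refl) v∈q = inj₁ v∈q
    Run-meet y∈ (go _ _) _ (here refl) v∈q = inj₁ v∈q
    Run-meet y∈ (go eq ρ) ρ′ (there v∈p) v∈q with Run-meet y∈ ρ ρ′ v∈p v∈q
    ... | inj₂ y∈p = inj₂ (there y∈p)
    ... | inj₁ w∈q with Run-predecessor ρ′ w∈q
    ...   | inj₁ refl            = contradiction y∈ (avoids eq)
    ...   | inj₂ (u , u∈q , eq′) = inj₁ (subst (_∈ˡ _) (step-injective (trans eq′ (sym eq))) u∈q)

    start-∈ : ∀ {x y q} → x ∈ X → Run y q → x ∈ˡ toList q → x ≡ y
    start-∈ x∈X ρ x∈q with Run-predecessor ρ x∈q
    ... | inj₁ eq          = eq
    ... | inj₂ (_ , _ , eq) = contradiction x∈X (avoids eq)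

    Run-disjoint : ∀ {x y p q v} → x ∈ X → y ∈ X → Run x p → Run y q →
                   v ∈ˡ toList p → v ∈ˡ toList q → p ≡ q
    Run-disjoint x∈ y∈ ρ ρ′ v∈p v∈q
      with refl ← [ start-∈ x∈ ρ′ , sym ∘ start-∈ y∈ ρ ]′ (Run-meet y∈ ρ ρ′ v∈p v∈q) =
      Run-deterministic ρ ρ′

    -- P holds the vertices already visited; each of them, and v, is the start or follows one in P.
    run : ∀ {x} → x ∈ X → ∃ (Run x)
    run {x} x∈X = from order x ⊥ ∉⊥ (λ { (inj₁ y∈⊥) → contradiction y∈⊥ ∉⊥ ; (inj₂ refl) → inj₁ refl })
      (trans (cong (order +_) (∣⊥∣≡0 order)) (ℕ.+-identityʳ order))
      where
      from : ∀ k v P → v ∉ P →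
             (∀ {y} → y ∈ P ⊎ y ≡ v → y ≡ x ⊎ ∃[ u ] u ∈ P × step u ≡ inj₁ y) →
             k + ∣ P ∣ ≡ order → ∃ (Run v)
      from zero    v P v∉P visited eq = contradiction (subst (v ∈_) (sym (∣p∣≡n⇒p≡⊤ eq)) ∈⊤) v∉P
      from (suc k) v P v∉P visited eq with step v in eqv
      ... | inj₂ s = _ , stop eqv
      ... | inj₁ w = let p , ρ = from k w (P ∪ ⁅ v ⁆) w∉ visited′ eq′ in _ , go eqv ρ
        where
        split : ∀ {y} → y ∈ P ∪ ⁅ v ⁆ → y ∈ P ⊎ y ≡ v
        split y∈ = [ inj₁ , inj₂ ∘ x∈⁅y⁆⇒x≡y _ ] (x∈p∪q⁻ P ⁅ v ⁆ y∈)
        -- A visited `w` would be `x`, into which nothing steps, or would follow a vertex of `P`,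
        -- which injectivity identifies with `v`. So each step visits a new vertex, and the number
        -- `k` of vertices outside `P` drops.
        w∉ : w ∉ P ∪ ⁅ v ⁆
        w∉ w∈ with visited (split w∈)
        ... | inj₁ refl            = avoids eqv x∈X
        ... | inj₂ (u , u∈ , equ) = v∉P (subst (_∈ P) (step-injective (trans equ (sym eqv))) u∈)
        visited′ : ∀ {y} → y ∈ P ∪ ⁅ v ⁆ ⊎ y ≡ w → y ≡ x ⊎ ∃[ u ] u ∈ P ∪ ⁅ v ⁆ × step u ≡ inj₁ y
        visited′ (inj₂ refl) = inj₂ (v , q⊆p∪q P _ (x∈⁅x⁆ v) , eqv)
        visited′ (inj₁ y∈) with visited (split y∈)
        ... | inj₁ y≡x            = inj₁ y≡x
        ... | inj₂ (u , u∈ , equ) = inj₂ (u , p⊆p∪q _ u∈ , equ)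
        eq′ : k + ∣ P ∪ ⁅ v ⁆ ∣ ≡ order
        eq′ = trans (cong (k +_) (∣∪⁅⁆∣ P v∉P)) (trans (ℕ.+-suc k _) eq)

    pathsFrom : ∀ x → Dec (x ∈ X) → List (List⁺ (Fin order))
    pathsFrom x (yes x∈) = proj₁ (run x∈) ∷ []
    pathsFrom x (no _)   = []

    runs : List (List⁺ (Fin order))
    runs = concatMap (λ x → pathsFrom x (x ∈? X)) (allFin order)

    ∈-runs⁻ : ∀ {p} → p ∈ˡ runs → ∃[ x ] x ∈ X × Run x p
    ∈-runs⁻ p∈
      with x , _ , p∈′ ← find (∈-concatMap⁻ (λ x → pathsFrom x (x ∈? X)) {xs = allFin order} p∈)
      with x ∈? X | p∈′
    ... | yes x∈ | here refl = x , x∈ , proj₂ (run x∈)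

    ∈-runs⁺ : ∀ {x} → x ∈ X → ∃[ p ] p ∈ˡ runs × head p ≡ x
    ∈-runs⁺ {x} x∈ = let p , p∈ , eq = found (x ∈? X) in
      p , ∈-concatMap⁺ (λ x → pathsFrom x (x ∈? X)) (lose (∈-allFin x) p∈) , eq
      where
      found : (x∈? : Dec (x ∈ X)) → ∃[ p ] p ∈ˡ pathsFrom x x∈? × head p ≡ x
      found (yes x∈) = _ , here refl , Run-head (proj₂ (run x∈))
      found (no x∉)  = contradiction x∈ x∉

    linkage⇒routing : ∃ (IsRouting D X T)
    linkage⇒routing = runs , record
      { paths    = λ p∈ → let _ , _ , ρ = ∈-runs⁻ p∈ in Run-linked ρ , Run-unique ρ
      ; starts   = ∈-runs⁺
      ; ends     = λ p∈ → let _ , _ , ρ = ∈-runs⁻ p∈ in Run-last ρ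
      ; disjoint = λ p∈ q∈ p≢q (v∈p , v∈q) →
          let _ , x∈ , ρ = ∈-runs⁻ p∈ ; _ , y∈ , ρ′ = ∈-runs⁻ q∈ in
          p≢q (Run-disjoint x∈ y∈ ρ ρ′ v∈p v∈q)
      }

-- Duality

module _ {U : Set} (M : Matroid U) where

  ∃-base-⊇ : ∀ {X} → Indep M X → ∃[ B ] Base M B × X ⊆ B
  ∃-base-⊇ {X} iX with B , bB ← ∃-base M
    with K , iK , X⊆K , _ , eq ← extend M (∣ B ∣ ∸ ∣ X ∣) iX (proj₁ bB)
                                   (ℕ.m∸n+n≡m (base-maximum M bB iX)) =
    K , maximum-base M bB iK eq , X⊆K

  -- If a dual independent set contains `∁ B` and avoids the base `B′`, then `B′` lies inside `B`,
  -- and maximality of `B′` makes the two equal.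
  ∁-base : ∀ {B} → Base M B → Base (M *) (∁ B)
  ∁-base {B} bB = (B , bB , id) , maximal
    where
    maximal : ∀ {Y} → DualIndep M Y → ∁ B ⊆ Y → Y ⊆ ∁ B
    maximal (B′ , bB′ , Y⊆∁B′) ∁B⊆Y = p⊆q⇒∁p⊇∁q B⊆B′ ∘ Y⊆∁B′
      where
      B⊆B′ : B ⊆ B′
      B⊆B′ = proj₂ bB′ (proj₁ bB) (∁p⊆∁q⇒p⊇q (Y⊆∁B′ ∘ ∁B⊆Y))

  -- A base of the dual that lies in `∁ B` is all of `∁ B`, so a set avoiding it lies in `B`.
  dual-involutive : M ≅ M * *
  dual-involutive = record
    { bijection = ↔-id _
    ; indep⇔    = λ X → let eq = image-id id (λ _ → refl) X in
        mk⇔ (subst (DualIndep (M *)) (sym eq) ∘ to) (from ∘ subst (DualIndep (M *)) eq)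
    }
    where
    to : ∀ {X} → Indep M X → DualIndep (M *) X
    to iX with B , bB , X⊆B ← ∃-base-⊇ iX =
      ∁ B , ∁-base bB , λ x∈ → x∉p⇒x∈∁p (x∈p⇒x∉∁p (X⊆B x∈))
    from : ∀ {X} → DualIndep (M *) X → Indep M X
    from (C , ((B , bB , C⊆∁B) , maximal) , X⊆∁C) = indep-⊆ M
      (λ x∈ → x∉∁p⇒x∈p λ x∈∁B → x∈∁p⇒x∉p (X⊆∁C x∈) (maximal (B , bB , id) C⊆∁B x∈∁B))
      (proj₁ bB)

gammoid-≅ : {U : Set} {M N : Matroid U} → N ≅ M → Gammoid M → Gammoid N
gammoid-≅ {M = M} {N} φ rep = record
  { D           = D
  ; T           = T
  ; e           = e ∘ to
  ; e-injective = injective ∘ e-injective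
  ; represents  = (λ {X} iX → subst Routable (image-∘ e to X)
                    (proj₁ represents (Equivalence.to (indep⇔ X) iX)))
                , (λ {X} routing → Equivalence.from (indep⇔ X)
                    (proj₂ represents (subst Routable (sym (image-∘ e to X)) routing)))
  }
  where
  open Representation rep
  open _≅_ φ
  open Inverse bijection using (to; from; strictlyInverseʳ)
  Routable : Subset (Digraph.order D) → Set
  Routable X = ∃ (IsRouting D X T)
  injective : ∀ {i j} → to i ≡ to j → i ≡ j
  injective {i} {j} eq = trans (sym (strictlyInverseʳ i)) (trans (cong from eq) (strictlyInverseʳ j))

-- The digraph representing the dual.

module DualRepresentation {U : Set} (M : Matroid U) (rep : Gammoid M)
                          {B₀ : Subset (size M)} (bB₀ : Base M B₀) where
  open Representation rep
  open Digraph D using (order)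

  rank : ℕ
  rank = ∣ B₀ ∣

  linkage : ∀ {B} → Indep M B → ∣ B ∣ ≡ rank → Linkage D T (image e B) rank
  linkage {B} iB eq with R , routing ← proj₁ represents iB =
    subst (Linkage D T (image e B)) (trans (∣image∣ e e-injective B) eq) (routing⇒linkage D T R routing)

  -- Together with `avoids`, this makes the sum of the linkage and the inclusion of `B` a bijection
  -- onto the targets.
  covers : ∀ {B} → ∣ B ∣ ≡ rank → (L : Linkage D T (image e B) rank) → ∀ w →
           (∃[ v ] Linkage.step L v ≡ w) ⊎ (∃[ i ] i ∈ B × w ≡ inj₁ (e i))
  covers {B} eq L (inj₂ s) = inj₁ (exhausts D T L (trans (∣image∣ e e-injective B) eq) (inj₂ s) λ ())
  covers {B} eq L (inj₁ x) with x ∈? image e B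
  ... | yes x∈ with i , i∈ , refl ← ∈-image⁻ e B x∈ = inj₂ (i , i∈ , refl)
  ... | no  x∉ = inj₁ (exhausts D T L (trans (∣image∣ e e-injective B) eq) (inj₁ x) λ { refl → x∉ })

  σ₀ : Linkage D T (image e B₀) rank
  σ₀ = linkage (proj₁ bB₀) refl

  module σ₀ = Linkage σ₀

  Target : Set
  Target = Fin order ⊎ Fin rank

  Vertex : Set
  Vertex = Fin order ⊎ Fin (size M)

  element-value : ∀ i → Dec (i ∈ B₀) → Target ⊎ Fin (size M)
  element-value i (yes _) = inj₁ (inj₁ (e i))
  element-value i (no _)  = inj₂ i

  -- ρ a = inj₂ i encodes that ρ is undefined at a = inj₂ i, where i ∉ B₀.
  ρ : Vertex → Target ⊎ Fin (size M)
  ρ (inj₁ v) = inj₁ (σ₀.step v)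
  ρ (inj₂ i) = element-value i (i ∈? B₀)

  -- The values that the sum of a linkage and the inclusion of a base may take at a vertex: at a
  -- copied element `i`, only `e i`.
  Head : Vertex → Target → Set
  Head (inj₁ v) w = Admissible D T v w
  Head (inj₂ i) w = w ≡ inj₁ (e i)

  head? : ∀ b w → Dec (Head b w)
  head? (inj₁ v) w = admissible? D T v w
  head? (inj₂ i) w = ≡-dec Fin._≟_ Fin._≟_ w (inj₁ (e i))

  -- The empty case makes the elements outside `B₀`, which are the targets of `D*`, sinks.
  HeadOf : Vertex → Target ⊎ Fin (size M) → Set
  HeadOf b (inj₁ w) = Head b w
  HeadOf b (inj₂ _) = Empty.⊥

  headOf? : ∀ b s → Dec (HeadOf b s)
  headOf? b (inj₁ w) = head? b w
  headOf? b (inj₂ _) = no λ ()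

  D* : Digraph
  D* = record
    { order = order + size M
    ; Arc   = λ u v → HeadOf (splitAt order v) (ρ (splitAt order u))
    ; arc?  = λ u v → headOf? (splitAt order v) (ρ (splitAt order u))
    }

  e* : Fin (size M) → Fin (order + size M)
  e* = order ↑ʳ_

  T* : Subset (order + size M)
  T* = image e* (∁ B₀)

  e*-injective : Injective _≡_ _≡_ e*
  e*-injective = Fin.↑ʳ-injective order _ _

  σ₀≢e : ∀ {v i} → i ∈ B₀ → σ₀.step v ≢ inj₁ (e i)
  σ₀≢e i∈ eq = σ₀.avoids eq (∈-image⁺ e B₀ i∈)

  -- The values on `V` and on `B₀` cannot clash because `σ₀` avoids the image of `B₀`.
  ρ-injective : Injective _≡_ _≡_ ρ
  ρ-injective {inj₁ v} {inj₁ v′} eq = cong inj₁ (σ₀.step-injective (inj₁-injective eq))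
  ρ-injective {inj₁ v} {inj₂ j}  eq with j ∈? B₀
  ... | yes j∈ = contradiction (inj₁-injective eq) (σ₀≢e j∈)
  ρ-injective {inj₂ i} {inj₁ v}  eq with i ∈? B₀
  ... | yes i∈ = contradiction (sym (inj₁-injective eq)) (σ₀≢e i∈)
  ρ-injective {inj₂ i} {inj₂ j}  eq with i ∈? B₀ | j ∈? B₀
  ... | yes _ | yes _ = cong inj₂ (e-injective (inj₁-injective (inj₁-injective eq)))
  ... | no _  | no _  = cong inj₂ (inj₂-injective eq)

  ρ-surjective : ∀ w → ∃[ a ] ρ a ≡ inj₁ w
  ρ-surjective w with covers refl σ₀ w
  ... | inj₁ (v , eq) = inj₁ v , cong inj₁ eq
  ... | inj₂ (i , i∈ , refl) = inj₂ i , lemma (i ∈? B₀)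
    where
    lemma : (d : Dec (i ∈ B₀)) → element-value i d ≡ inj₁ (inj₁ (e i))
    lemma (yes _) = refl
    lemma (no i∉) = contradiction i∈ i∉

  ρ-undefined : ∀ {a i} → ρ a ≡ inj₂ i → a ≡ inj₂ i × i ∉ B₀
  ρ-undefined {inj₂ j} eq with j ∈? B₀ | eq
  ... | no j∉ | refl = refl , j∉

  ρ-at-target : ∀ {i} → i ∉ B₀ → ρ (inj₂ i) ≡ inj₂ i
  ρ-at-target {i} i∉ with i ∈? B₀
  ... | yes i∈ = contradiction i∈ i∉
  ... | no _   = refl

  -- Hence fixing a vertex where `ρ` is defined obeys the same condition as following an arc of
  -- `D*`.
  head-self : ∀ a {w} → ρ a ≡ inj₁ w → Head a w
  head-self (inj₁ v) refl = σ₀.admissible v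
  head-self (inj₂ i) eq with i ∈? B₀ | eq
  ... | yes _ | refl = refl

  -- From a base avoiding `X` to a linkage in `D*`.

  module Forward {B X : Subset (size M)} (bB : Base M B) (X⊆∁B : X ⊆ ∁ B) where

    ∣B∣≡rank : ∣ B ∣ ≡ rank
    ∣B∣≡rank = ℕ.≤-antisym (base-maximum M bB₀ (proj₁ bB)) (base-maximum M bB (proj₁ bB₀))

    σ : Linkage D T (image e B) rank
    σ = linkage (proj₁ bB) ∣B∣≡rank

    module σ = Linkage σ

    -- The graph of the bijection formed by `σ` and the inclusion of `B`; `origin` is its inverse.
    data Origin : Vertex → Target → Set where
      step : ∀ {v w} → σ.step v ≡ w → Origin (inj₁ v) w
      base : ∀ {i} → i ∈ B → Origin (inj₂ i) (inj₁ (e i))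

    origin : ∀ w → ∃[ a ] Origin a w
    origin w with covers ∣B∣≡rank σ w
    ... | inj₁ (v , eq)        = inj₁ v , step eq
    ... | inj₂ (i , i∈ , refl) = inj₂ i , base i∈

    origin-functional : ∀ {a w w′} → Origin a w → Origin a w′ → w ≡ w′
    origin-functional (step refl) (step refl) = refl
    origin-functional (base _)    (base _)    = refl

    origin-head : ∀ {a w} → Origin a w → Head a w
    origin-head (step {v} refl) = σ.admissible v
    origin-head (base _)        = refl

    -- With all of `Fin (size M)` as extra values, each end vertex `i` leaves under its own name,
    -- which keeps the map injective.
    advance : Target ⊎ Fin (size M) → Fin (order + size M) ⊎ Fin (size M)
    advance (inj₁ w) = inj₁ (join order (size M) (proj₁ (origin w)))
    advance (inj₂ i) = inj₂ i

    advance-injective : Injective _≡_ _≡_ advance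
    advance-injective {inj₁ w} {inj₁ w′} eq = cong inj₁ (origin-functional
      (subst (λ a → Origin a w) (join-injective order (inj₁-injective eq)) (proj₂ (origin w)))
      (proj₂ (origin w′)))
    advance-injective {inj₂ i} {inj₂ j} eq = cong inj₂ (inj₂-injective eq)

    linkage* : Linkage D* T* (image e* X) (size M)
    linkage* = record
      { step           = advance ∘ ρ ∘ splitAt order
      ; step-injective = λ {u} {v} eq → splitAt-injective order
          (ρ-injective {splitAt order u} {splitAt order v} (advance-injective eq))
      ; admissible     = admissible*
      ; avoids         = avoids*
      }
      where
      admissible* : ∀ u → Admissible D* T* u (advance (ρ (splitAt order u)))
      admissible* u with ρ (splitAt order u) in eq
      ... | inj₁ w = inj₂ (subst₂ HeadOf (sym (Fin.splitAt-join order _ (proj₁ (origin w)))) (sym eq)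
                            (origin-head (proj₂ (origin w))))
      ... | inj₂ i with eq′ , i∉ ← ρ-undefined eq =
        subst (_∈ T*) (Fin.splitAt⁻¹-↑ʳ {i = u} eq′) (∈-image⁺ e* (∁ B₀) (x∉p⇒x∈∁p i∉))

      -- A step to the copy of `j` means that the origin is a `base` vertex, so `j` lies in `B`,
      -- whereas `X` avoids `B`.
      avoids* : ∀ {u x} → advance (ρ (splitAt order u)) ≡ inj₁ x → x ∉ image e* X
      avoids* {u} eq x∈ with ρ (splitAt order u)
      ... | inj₁ w with j , j∈ , refl ← ∈-image⁻ e* X x∈
                   with origin w
      ...   | a , o with refl ← join-injective order {s = a} {inj₂ j} (inj₁-injective eq) with o
      ...     | base j∈B = x∈∁p⇒x∉p (X⊆∁B j∈) j∈B

  -- From a linkage in `D*` avoiding `X` to a base avoiding `X`.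

  module Backward {X : Subset (size M)} (τ : Linkage D* T* (image e* X) (∣ image e* X ∣)) where

    module τ = Linkage τ

    follow : ∀ {u v w} → τ.step u ≡ inj₁ v → ρ (splitAt order u) ≡ inj₁ w → Head (splitAt order v) w
    follow {u} {v} τu ρu with subst (Admissible D* T* u) τu (τ.admissible u)
    ... | inj₁ refl = head-self (splitAt order v) ρu
    ... | inj₂ arc  = subst (HeadOf (splitAt order v)) ρu arc

    abstract
      -- If `ρ` is undefined at `u`, then `u` is a copied element without outgoing arcs, so `τ` can
      -- neither move it nor, by fixing it, reach `V`.
      follow-defined : ∀ {u v} → τ.step u ≡ inj₁ (v ↑ˡ size M) → ∃[ w ] ρ (splitAt order u) ≡ inj₁ w
      follow-defined {u} {v} τu with ρ (splitAt order u) in eq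
      ... | inj₁ w = w , refl
      ... | inj₂ i with subst (Admissible D* T* u) τu (τ.admissible u)
      ...   | inj₁ refl with () ← trans (sym (Fin.splitAt-↑ˡ order v _)) (proj₁ (ρ-undefined eq))
      ...   | inj₂ arc  with () ← subst (HeadOf (splitAt order (v ↑ˡ size M))) eq arc

      predecessor : ∀ v → ∃[ u ] τ.step u ≡ inj₁ (v ↑ˡ size M)
      predecessor v = exhausts D* T* τ refl (inj₁ (v ↑ˡ size M)) λ { refl x∈ → v∉ (∈-image⁻ e* X x∈) }
        where
        v∉ : ¬ (∃[ i ] i ∈ X × e* i ≡ v ↑ˡ size M)
        v∉ (i , _ , eq) with () ← join-injective order {s = inj₂ i} {inj₁ v} eq

    pred : Fin order → Fin (order + size M)
    pred = proj₁ ∘ predecessor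

    τ-pred : ∀ v → τ.step (pred v) ≡ inj₁ (v ↑ˡ size M)
    τ-pred v = proj₂ (predecessor v)

    σ : Fin order → Target
    σ v = proj₁ (follow-defined (τ-pred v))

    ρ-pred : ∀ v → ρ (splitAt order (pred v)) ≡ inj₁ (σ v)
    ρ-pred v = proj₂ (follow-defined (τ-pred v))

    ρ-split-injective : ∀ {u u′ w} → ρ (splitAt order u) ≡ inj₁ w → ρ (splitAt order u′) ≡ inj₁ w → u ≡ u′
    ρ-split-injective {u} {u′} eq eq′ = splitAt-injective order
      (ρ-injective {splitAt order u} {splitAt order u′} (trans eq (sym eq′)))

    pred-injective : Injective _≡_ _≡_ pred
    pred-injective {v} {v′} eq = Fin.↑ˡ-injective (size M) v v′ (inj₁-injective
      (trans (sym (τ-pred v)) (trans (cong τ.step eq) (τ-pred v′))))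

    σ-injective : Injective _≡_ _≡_ σ
    σ-injective {v} {v′} eq = pred-injective
      (ρ-split-injective (ρ-pred v) (trans (ρ-pred v′) (cong inj₁ (sym eq))))

    σ-admissible : ∀ v → Admissible D T v (σ v)
    σ-admissible v = subst (λ b → Head b (σ v)) (Fin.splitAt-↑ˡ order v _)
      (follow (τ-pred v) (ρ-pred v))

    Missed : Pred (Fin (size M)) 0ℓ
    Missed i = ∀ v → σ v ≢ inj₁ (e i)

    missed? : Decidable Missed
    missed? i = Fin.all? λ v → ¬? (≡-dec Fin._≟_ Fin._≟_ (σ v) (inj₁ (e i)))

    B : Subset (size M)
    B = select missed?

    -- Recording `i ∉ X` lets the same covering yield both that `B` is large enough and that it
    -- avoids `X`.
    Covered : Target → Set
    Covered w = (∃[ v ] σ v ≡ w) ⊎ (∃[ i ] i ∈ B × i ∉ X × w ≡ inj₁ (e i))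

    -- Apply `τ` to the vertex `u` with `ρ`-value `w`. It cannot exit, since `ρ` is undefined at the
    -- targets. If it lands at `v` in `V`, then `u` is `pred v` and `w` is `σ v`. If it lands at the
    -- copy of `i`, then `w` is `e i`; were this also `σ v`, then `u` would be `pred v`, which `τ`
    -- sends into `V`.
    cover-by : ∀ {w} u → ρ (splitAt order u) ≡ inj₁ w → ∀ s → τ.step u ≡ s → Covered w
    cover-by u ρu (inj₂ s) τu
      with i , i∈ , refl ← ∈-image⁻ e* (∁ B₀) (subst (Admissible D* T* u) τu (τ.admissible u))
      with () ← trans (sym (ρ-at-target (x∈∁p⇒x∉p i∈)))
        (trans (cong ρ (sym (Fin.splitAt-↑ʳ order (size M) i))) ρu)
    cover-by {w} u ρu (inj₁ x) τu = land (splitAt order x) refl (follow τu ρu)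
      where
      land : ∀ b → splitAt order x ≡ b → Head (splitAt order x) w → Covered w
      land (inj₁ v) eq _ = inj₁ (v , inj₁-injective (trans (sym (ρ-pred v)) (trans
        (cong (ρ ∘ splitAt order) (τ.step-injective (trans (τ-pred v)
          (trans (cong inj₁ (Fin.splitAt⁻¹-↑ˡ {i = x} eq)) (sym τu))))) ρu)))
      land (inj₂ i) eq head = inj₂ (i , ∈-select⁺ missed? missed
        , (λ i∈ → τ.avoids τu′ (∈-image⁺ e* X i∈)) , w≡ei)
        where
        τu′ : τ.step u ≡ inj₁ (e* i)
        τu′ = trans τu (cong inj₁ (sym (Fin.splitAt⁻¹-↑ʳ {i = x} eq)))
        w≡ei : w ≡ inj₁ (e i)
        w≡ei = subst (λ b → Head b w) eq head
        missed : Missed i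
        missed v σv with u≡ ← ρ-split-injective ρu (trans (ρ-pred v) (cong inj₁ (trans σv (sym w≡ei))))
          with () ← join-injective order {s = inj₁ v} {inj₂ i} (inj₁-injective
            (trans (sym (τ-pred v)) (trans (cong τ.step (sym u≡)) τu′)))

    cover : ∀ w → Covered w
    cover w = let a , ρa = ρ-surjective w ; u = join order (size M) a in
      cover-by u (trans (cong ρ (Fin.splitAt-join order (size M) a)) ρa) (τ.step u) refl

    -- For `x` in both sets, `e x` could be covered neither by `σ`, which misses it, nor by an
    -- element outside `X`.
    X⊆∁B : X ⊆ ∁ B
    X⊆∁B {x} x∈ = x∉p⇒x∈∁p λ x∈B → miss x∈B (cover (inj₁ (e x)))
      where
      miss : x ∈ B → ¬ _
      miss x∈B (inj₁ (v , eq)) = ∈-select⁻ missed? x∈B v eq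
      miss _   (inj₂ (i , _ , i∉ , eq)) =
        i∉ (subst (_∈ X) (e-injective (inj₁-injective eq)) x∈)

    linkageB : Linkage D T (image e B) rank
    linkageB = record
      { step           = σ
      ; step-injective = σ-injective
      ; admissible     = σ-admissible
      ; avoids         = avoidsB
      }
      where
      avoidsB : ∀ {v x} → σ v ≡ inj₁ x → x ∉ image e B
      avoidsB {v} eq x∈ with i , i∈ , refl ← ∈-image⁻ e B x∈ = ∈-select⁻ missed? i∈ v eq

    indepB : Indep M B
    indepB = proj₂ represents (linkage⇒routing D T linkageB)

    -- All `order + rank` targets are covered by the `order` values of `σ` and the elements of `B`.
    rank≤∣B∣ : rank ≤ ∣ B ∣
    rank≤∣B∣ = ℕ.+-cancelˡ-≤ order _ _ (covering⇒≤ {f = join order rank ∘ σ} {g = λ i → e i ↑ˡ rank}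
      (σ-injective ∘ join-injective order {rank}) (e-injective ∘ Fin.↑ˡ-injective rank _ _) B cover′)
      where
      cover′ : ∀ y → (∃[ v ] join order rank (σ v) ≡ y) ⊎ (∃[ i ] i ∈ B × e i ↑ˡ rank ≡ y)
      cover′ y with cover (splitAt order y)
      ... | inj₁ (v , eq) = inj₁ (v , trans (cong (join order rank) eq) (Fin.join-splitAt order rank y))
      ... | inj₂ (i , i∈ , _ , eq) = inj₂ (i , i∈ , Fin.splitAt⁻¹-↑ˡ {i = y} eq)

    dualIndep : DualIndep M X
    dualIndep = B , maximum-base M bB₀ indepB (ℕ.≤-antisym (base-maximum M bB₀ indepB) rank≤∣B∣) , X⊆∁B

gammoid-dual : {U : Set} {M : Matroid U} → Gammoid M → Gammoid (M *)
gammoid-dual {M = M} rep = record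
  { D           = D*
  ; T           = T*
  ; e           = e*
  ; e-injective = e*-injective
  ; represents  = (λ (_ , bB , X⊆∁B) → linkage⇒routing D* T* (Forward.linkage* bB X⊆∁B))
                , (λ (R , routing) → Backward.dualIndep (routing⇒linkage D* T* R routing))
  }
  where open DualRepresentation M rep (proj₂ (∃-base M))

gammoid-undual : {U : Set} {M : Matroid U} → Gammoid (M *) → Gammoid M
gammoid-undual {M = M} = gammoid-≅ (dual-involutive M) ∘ gammoid-dual

gammoid-∼ : {U : Set} {M N : Matroid U} → M ∼ N → (Gammoid M → Gammoid N) × (Gammoid N → Gammoid M)
gammoid-∼ (inj₁ N≅M)  = gammoid-≅ N≅M , gammoid-≅ (≅-sym N≅M)
gammoid-∼ (inj₂ N≅M*) = gammoid-≅ N≅M* ∘ gammoid-dual , gammoid-undual ∘ gammoid-≅ (≅-sym N≅M*)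

-- Validity of the extended tableau.

module _ {U : Set} (𝐓 : Tableau U) (valid : Valid 𝐓) where
  open Tableau 𝐓
  open Valid valid
  private module ≃ = IsEquivalence isEquivalence

  duals-⇔ : ∀ {M N : Matroid U} → N ≈ M * → (Gammoid M → Gammoid N) × (Gammoid N → Gammoid M)
  duals-⇔ N≈M* = gammoid-∼ (inj₂ (_≈_.iso N≈M*))

  𝒢′-gammoids : ∀ {M} → Member (𝒢′ 𝐓) M → Gammoid M
  𝒢′-gammoids (inj₁ M∈)              = 𝒢-gammoids M∈
  𝒢′-gammoids (inj₂ (_ , M∈ , N≈M*)) = proj₁ (duals-⇔ N≈M*) (𝒢-gammoids M∈)

  𝒳′-nongammoids : ∀ {M} → Member (𝒳′ 𝐓) M → ¬ Gammoid M
  𝒳′-nongammoids (inj₁ M∈)              = 𝒳-nongammoids M∈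
  𝒳′-nongammoids (inj₂ (_ , M∈ , N≈M*)) = 𝒳-nongammoids M∈ ∘ proj₂ (duals-⇔ N≈M*)

  ℳ′-nonstrict : ∀ {M} → Member (ℳ′ 𝐓) M → ¬ StrictGammoid M
  ℳ′-nonstrict (inj₁ M∈) = ℳ-nonstrict M∈
  ℳ′-nonstrict (inj₂ M∈) = 𝒳′-nongammoids M∈ ∘ proj₁

  ≃-gammoid : ∀ {x y} → x ≃ y → Gammoid (proj₁ x) → Gammoid (proj₁ y)
  ≃-gammoid {x} {y} x≃y γ with classes x
  ... | inj₁ all  = all y x≃y
  ... | inj₂ none = contradiction γ (none x ≃.refl)

  -- Constructively this disjunction comes from validity: the class of `M` is homogeneous and
  -- contains `M`.
  original? : ∀ {M} → InDomain goal 𝒢 ℳ 𝒳 M → Gammoid M ⊎ ¬ Gammoid M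
  original? {M} m = [ (λ all → inj₁ (all (M , m) ≃.refl)) , (λ none → inj₂ (none (M , m) ≃.refl)) ]′
    (classes (M , m))

  gammoid? : ∀ {M} → InDomain goal (𝒢′ 𝐓) (ℳ′ 𝐓) (𝒳′ 𝐓) M → Gammoid M ⊎ ¬ Gammoid M
  gammoid? (inj₁ minor)                  = original? (inj₁ minor)
  gammoid? (inj₂ (inj₁ M∈))              = inj₁ (𝒢′-gammoids M∈)
  gammoid? (inj₂ (inj₂ (inj₁ (inj₁ M∈)))) = original? (inj₂ (inj₂ (inj₁ M∈)))
  gammoid? (inj₂ (inj₂ (inj₁ (inj₂ M∈)))) = inj₂ (𝒳′-nongammoids M∈)
  gammoid? (inj₂ (inj₂ (inj₂ M∈)))       = inj₂ (𝒳′-nongammoids M∈)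

  GammoidEq : Rel (Domain goal (𝒢′ 𝐓) (ℳ′ 𝐓) (𝒳′ 𝐓)) _
  GammoidEq x y = (Gammoid (proj₁ x) → Gammoid (proj₁ y)) × (Gammoid (proj₁ y) → Gammoid (proj₁ x))

  generator-gammoid : ∀ {x y} → Generator 𝐓 x y → GammoidEq x y
  generator-gammoid (from-≃ _ _ x≃y) = ≃-gammoid x≃y , ≃-gammoid (≃.sym x≃y)
  generator-gammoid (from-∼ x∼y)     = gammoid-∼ x∼y

  -- `GammoidEq` is an equivalence relation containing the generators, hence it contains the
  -- smallest such relation.
  class-gammoid : ∀ {x y} → EqClosure (Generator 𝐓) x y → GammoidEq x y
  class-gammoid = EqC.fold record
    { refl  = id , id
    ; sym   = λ (f , g) → g , f
    ; trans = λ (f , g) (f′ , g′) → f′ ∘ f , g ∘ g′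
    } generator-gammoid

lemma3p8 : ∀ {U : Set} (𝐓 : Tableau U) → Valid 𝐓 → Valid (extended 𝐓)
lemma3p8 𝐓 valid = record
  { 𝒢-gammoids    = 𝒢′-gammoids 𝐓 valid
  ; ℳ-nonstrict   = ℳ′-nonstrict 𝐓 valid
  ; 𝒳-nongammoids = 𝒳′-nongammoids 𝐓 valid
  ; classes       = λ (_ , m) →
      [ (λ γ → inj₁ λ _ x≃y → proj₁ (class-gammoid 𝐓 valid x≃y) γ)
      , (λ ¬γ → inj₂ λ _ x≃y → ¬γ ∘ proj₂ (class-gammoid 𝐓 valid x≃y))
      ]′ (gammoid? 𝐓 valid m)
  }
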